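{- Let $n$ be a prime, let $\alpha$ be a primitive element of $\mathbb{F}_{2^n}$, identify $\mathbb{F}_2^n$ with $\mathbb{F}_{2^n}$ as $\mathbb{F}_2$-vector spaces, and let $k\ge 2$. Suppose there exists a Steiner structure $\mathbb{S}_2[2,k,n]$ formed by $\frac{2^n-2}{(2^k-1)(2^k-2)n}$ pairwise disjoint coset complete $k$-dimensional subspaces $X_1,\dots,X_N$ (meaning that the set of all subspaces $\alpha^j X_i^{2^\ell}=\{\alpha^j x^{2^\ell}: x\in X_i\}$, $1\le i\le N$, $0\le \ell\le n-1$, $0\le j\le 2^n-2$, is a Steiner structure $\mathbb{S}_2[2,k,n]$). Then there exists a $(2^n-1,2^k-1,1)$ difference family over the group $\mathbb{Z}_{2^n-1}$.
   Context: For $s\in\mathbb{Z}_{2^n-1}$, the cyclotomic coset of $s$ is $C_s=\{s\cdot 2^i \bmod (2^n-1): 0\le i\le n-1\}$ and $\rho(s)=\min C_s$. For a $k$-dimensional subspace $X=\{0,\alpha^{i_1},\dots,\alpha^{i_{2^k-1}}\}$ (exponents in $\mathbb{Z}_{2^n-1}$), $\rho(\Delta(X))=\{\rho(i_r-i_s): r\ne s\}$; $X$ is coset complete if $|\rho(\Delta(X))|=(2^k-1)(2^k-2)$, and coset complete $X,Y$ are disjoint if $\rho(\Delta(X))\cap\rho(\Delta(Y))=\varnothing$. A Steiner structure $\mathbb{S}_2[2,k,n]$ is a set of $k$-dimensional subspaces of $\mathbb{F}_2^n$ such that every $2$-dimensional subspace is contained in exactly one of them. An $(m,w,\lambda)$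 difference family over an additive group $G$ with $|G|=m$ is a set of $w$-subsets of $G$ such that each element of $G\setminus\{0\}$ occurs exactly $\lambda$ times as a difference $a-b$ of two distinct elements $a,b$ lying in a common subset of the family. -}

module Defs where

open import Algebra.Bundles using (CommutativeRing; CommutativeMonoid)
open import Algebra.Core using (Op₁; Op₂)
open import Algebra.Module.Bundles using (Module)
import Algebra.Module.Structures.Biased as Biased
import Algebra.Properties.CommutativeMonoid.Sum as Sum
import Algebra.Properties.Group as GroupProperties
import Algebra.Properties.Semiring.Exp as Exp
import Algebra.Properties.Semiring.Mult as Mult
open import Algebra.Structures using (IsGroup)
open import Data.Bool.Base using (Bool; true; false; if_then_else_; _∧_; _xor_)
open import Data.Bool.Properties using (xor-∧-commutativeRing)
open import Data.Fin.Base using (Fin; toℕ)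
open import Data.Fin.Permutation using (Permutation′; permutation)
import Data.Fin.Properties as Fin
open import Data.Fin.Subset as Subset using (Subset; ∣_∣)
open import Data.List.Base using (List; length; map; upTo)
import Data.List.Extrema as Extrema
open import Data.List.Membership.Propositional using (_∈_)
open import Data.List.Relation.Unary.Unique.Propositional using (Unique)
open import Data.Nat.Base using (ℕ; zero; suc; _+_; _*_; _∸_; _^_; _%_; NonZero; >-nonZero; >-nonZero⁻¹)
open import Data.Nat.DivMod using (_mod_; %-distribˡ-+; m%n%n≡m%n; m<n⇒m%n≡m; n%n≡0)
import Data.Nat.Properties as ℕ
open import Data.Product.Base using (Σ-syntax; ∃; ∃-syntax; _×_; _,_; proj₁; proj₂)
open import Function.Base using (_∘_)
open import Function.Bundles using (Inverse; _⇔_)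
open import Level using (Level; _⊔_; 0ℓ) renaming (suc to lsuc)
open import Relation.Binary.PropositionalEquality as ≡ using (_≡_; _≢_; module ≡-Reasoning)
import Relation.Binary.Reasoning.Setoid as ≈-Reasoning
open import Relation.Nullary using (¬_; yes; no; contradiction)
open import Relation.Unary using (Pred; U; _≐_) renaming (_∈_ to _∈ₚ_; _⊆_ to _⊆ₚ_; _⊥_ to _⊥ₚ_)

private
  variable
    a c ℓ p q : Level

HasSize : {A : Set a} → Pred A p → ℕ → Set (a ⊔ p)
HasSize {A = A} P s =
  Σ[ xs ∈ List A ] Unique xs × (∀ x → x ∈ xs ⇔ x ∈ₚ P) × length xs ≡ s

module ℤmod (m : ℕ) .{{_ : NonZero m}} where

  infixl 6 _+ₘ_ _-ₘ_

  _+ₘ_ : Op₂ (Fin m)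
  x +ₘ y = (toℕ x + toℕ y) mod m

  0ₘ : Fin m
  0ₘ = 0 mod m

  neg : Op₁ (Fin m)
  neg x = (m ∸ toℕ x) mod m

  _-ₘ_ : Op₂ (Fin m)
  x -ₘ y = x +ₘ neg y

  toℕ-mod : ∀ x → toℕ (x mod m) ≡ x % m
  toℕ-mod x = Fin.toℕ-fromℕ< _

  %-+ˡ : ∀ x y → (x % m + y) % m ≡ (x + y) % m
  %-+ˡ x y = begin
    (x % m + y) % m          ≡⟨ %-distribˡ-+ (x % m) y m ⟩
    (x % m % m + y % m) % m  ≡⟨ ≡.cong (λ z → (z + y % m) % m) (m%n%n≡m%n x m) ⟩
    (x % m + y % m) % m      ≡⟨ %-distribˡ-+ x y m ⟨
    (x + y) % m              ∎
    where open ≡-Reasoning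

  mod-cong : ∀ {x y} → x % m ≡ y % m → x mod m ≡ y mod m
  mod-cong {x} {y} eq = Fin.toℕ-injective (≡.trans (toℕ-mod x) (≡.trans eq (≡.sym (toℕ-mod y))))

  mod-toℕ : ∀ x → toℕ x mod m ≡ x
  mod-toℕ x = Fin.toℕ-injective (≡.trans (toℕ-mod (toℕ x)) (m<n⇒m%n≡m (Fin.toℕ<n x)))

  mod-+ˡ : ∀ x y → (toℕ (x mod m) + y) mod m ≡ (x + y) mod m
  mod-+ˡ x y = mod-cong (≡.trans (≡.cong (λ z → (z + y) % m) (toℕ-mod x)) (%-+ˡ x y))

  +ₘ-comm : ∀ x y → x +ₘ y ≡ y +ₘ x
  +ₘ-comm x y = ≡.cong (_mod m) (ℕ.+-comm (toℕ x) (toℕ y))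

  +ₘ-assoc : ∀ x y z → (x +ₘ y) +ₘ z ≡ x +ₘ (y +ₘ z)
  +ₘ-assoc x y z = begin
    (x +ₘ y) +ₘ z                       ≡⟨ mod-+ˡ (toℕ x + toℕ y) (toℕ z) ⟩
    (toℕ x + toℕ y + toℕ z) mod m       ≡⟨ ≡.cong (_mod m) (ℕ.+-assoc (toℕ x) _ _) ⟩
    (toℕ x + (toℕ y + toℕ z)) mod m     ≡⟨ ≡.cong (_mod m) (ℕ.+-comm (toℕ x) _) ⟩
    (toℕ y + toℕ z + toℕ x) mod m       ≡⟨ mod-+ˡ (toℕ y + toℕ z) (toℕ x) ⟨
    (y +ₘ z) +ₘ x                       ≡⟨ +ₘ-comm (y +ₘ z) x ⟩
    x +ₘ (y +ₘ z)                       ∎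
    where open ≡-Reasoning

  +ₘ-identityˡ : ∀ x → 0ₘ +ₘ x ≡ x
  +ₘ-identityˡ x = ≡.trans (mod-+ˡ 0 (toℕ x)) (mod-toℕ x)

  +ₘ-inverseˡ : ∀ x → neg x +ₘ x ≡ 0ₘ
  +ₘ-inverseˡ x = begin
    neg x +ₘ x                   ≡⟨ mod-+ˡ (m ∸ toℕ x) (toℕ x) ⟩
    (m ∸ toℕ x + toℕ x) mod m     ≡⟨ ≡.cong (_mod m) (ℕ.m∸n+n≡m (ℕ.<⇒≤ (Fin.toℕ<n x))) ⟩
    m mod m                       ≡⟨ mod-cong (≡.trans (n%n≡0 m) (≡.sym (m<n⇒m%n≡m (>-nonZero⁻¹ m)))) ⟩
    0ₘ                            ∎
    where open ≡-Reasoning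

  isGroup : IsGroup _≡_ _+ₘ_ 0ₘ neg
  isGroup = record
    { isMonoid = record
      { isSemigroup = record
        { isMagma = ≡.isMagma _+ₘ_
        ; assoc   = +ₘ-assoc
        }
      ; identity = +ₘ-identityˡ , λ x → ≡.trans (+ₘ-comm x 0ₘ) (+ₘ-identityˡ x)
      }
    ; inverse = +ₘ-inverseˡ , λ x → ≡.trans (+ₘ-comm x (neg x)) (+ₘ-inverseˡ x)
    ; ⁻¹-cong = ≡.cong neg
    }

-- A group of order m is presented on the carrier Fin m, so that its
-- subsets are the library's `Subset m`; a finite set of subsets is a
-- duplicate-free list.  Differences are counted with multiplicity, one
-- for each triple (B , x , y).

module _ {m : ℕ} {_+ᴳ_ : Op₂ (Fin m)} {0ᴳ : Fin m} { -ᴳ_ : Op₁ (Fin m)} where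

  IsDifferenceTriple : List (Subset m) → Fin m → Pred (Subset m × Fin m × Fin m) 0ℓ
  IsDifferenceTriple 𝓑 d (B , x , y) =
    B ∈ 𝓑 × x Subset.∈ B × y Subset.∈ B × x ≢ y × x +ᴳ (-ᴳ y) ≡ d

  record IsDifferenceFamily (G : IsGroup _≡_ _+ᴳ_ 0ᴳ -ᴳ_) (w lam : ℕ)
                            (𝓑 : List (Subset m)) : Set where
    field
      unique      : Unique 𝓑
      block-size  : ∀ B → B ∈ 𝓑 → ∣ B ∣ ≡ w
      differences : ∀ d → d ≢ 0ᴳ → HasSize (IsDifferenceTriple 𝓑 d) lam

𝔽₂ : CommutativeRing 0ℓ 0ℓ
𝔽₂ = xor-∧-commutativeRing

module _ (V : Module 𝔽₂ c ℓ) where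
  open Module V
  open Sum +ᴹ-commutativeMonoid using (sum)

  record IsSubspace (W : Pred Carrierᴹ p) : Set (c ⊔ ℓ ⊔ p) where
    field
      resp      : ∀ {x y} → x ≈ᴹ y → x ∈ₚ W → y ∈ₚ W
      0-closed  : 0ᴹ ∈ₚ W
      +-closed  : ∀ {x y} → x ∈ₚ W → y ∈ₚ W → (x +ᴹ y) ∈ₚ W
      *ₗ-closed : ∀ b {x} → x ∈ₚ W → (b *ₗ x) ∈ₚ W

  linComb : ∀ {k} → (Fin k → Bool) → (Fin k → Carrierᴹ) → Carrierᴹ
  linComb b v = sum (λ i → b i *ₗ v i)

  record IsBasis {k} (W : Pred Carrierᴹ p) (v : Fin k → Carrierᴹ) : Set (c ⊔ ℓ ⊔ p) where
    field
      inside      : ∀ i → v i ∈ₚ W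
      independent : ∀ b → linComb b v ≈ᴹ 0ᴹ → ∀ i → b i ≡ false
      spanning    : ∀ {x} → x ∈ₚ W → ∃[ b ] x ≈ᴹ linComb b v

  record IsSubspaceOfDim (k : ℕ) (W : Pred Carrierᴹ p) : Set (c ⊔ ℓ ⊔ p) where
    field
      isSubspace : IsSubspace W
      basis      : Fin k → Carrierᴹ
      isBasis    : IsBasis W basis

  -- A Steiner structure 𝕊₂[2,k,n].  The ambient space 𝔽₂ⁿ is rendered as
  -- a vector space V with a basis of n vectors, and sets of subspaces are
  -- understood up to extensional equality of subspaces.
  record IsSteinerStructure (k n : ℕ) (S : Pred (Pred Carrierᴹ p) q)
                            : Set (c ⊔ ℓ ⊔ lsuc p ⊔ q) where
    field
      ambient : IsSubspaceOfDim n (U {A = Carrierᴹ})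
      blocks  : ∀ B → B ∈ₚ S → IsSubspaceOfDim k B
      covers  : ∀ (T : Pred Carrierᴹ p) → IsSubspaceOfDim 2 T →
                ∃[ B ] (B ∈ₚ S × T ⊆ₚ B × (∀ B′ → B′ ∈ₚ S → T ⊆ₚ B′ → B′ ≐ B))

record FiniteField (c ℓ : Level) (size : ℕ) : Set (lsuc (c ⊔ ℓ)) where
  field
    commutativeRing : CommutativeRing c ℓ
  open CommutativeRing commutativeRing public renaming (_+_ to _+ᶠ_; _*_ to _*ᶠ_; -_ to -ᶠ_)
  field
    1≉0         : ¬ 1# ≈ 0#
    inverses    : ∀ x → ¬ x ≈ 0# → ∃[ y ] x *ᶠ y ≈ 1#
    enumeration : Inverse (≡.setoid (Fin size)) setoid

  open Exp semiring public using () renaming (_^_ to infixr 8 _^ᶠ_)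

  IsPrimitive : Carrier → Set (c ⊔ ℓ)
  IsPrimitive α = ¬ α ≈ 0# × (∀ x → ¬ x ≈ 0# → ∃[ i ] x ≈ α ^ᶠ i)

-- A field with 2ⁿ elements has characteristic 2: summing x and x + 1 over
-- the whole field gives 2ⁿ × 1 ≈ 0, that is (1 + 1)ⁿ ≈ 0.
module _ (n : ℕ) (F : FiniteField c ℓ (2 ^ n)) where
  private
    module F = FiniteField F
    module E = Inverse F.enumeration
  open F using (Carrier; _≈_; _+ᶠ_; _*ᶠ_; -ᶠ_; 0#; 1#)
  private
    open Sum F.+-commutativeMonoid
      using (sum; sum-permute; sum-cong-≋; ∑-distrib-+; sum-replicate)
    open Mult F.semiring using (×1-homo-*; ×-homo-1) renaming (_×_ to _×ᶠ_)
    open GroupProperties F.+-group using (∙-cancelˡ)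
    open ≈-Reasoning F.setoid

    to-from : ∀ x → E.to (E.from x) ≈ x
    to-from = E.strictlyInverseˡ

    shift : Carrier → Fin (2 ^ n) → Fin (2 ^ n)
    shift y i = E.from (E.to i +ᶠ y)

    shift-shift : ∀ y z → y +ᶠ z ≈ 0# → ∀ i → shift z (shift y i) ≡ i
    shift-shift y z eq i = ≡.trans (E.from-cong (begin
      E.to (shift y i) +ᶠ z  ≈⟨ F.+-congʳ (to-from _) ⟩
      E.to i +ᶠ y +ᶠ z       ≈⟨ F.+-assoc _ _ _ ⟩
      E.to i +ᶠ (y +ᶠ z)     ≈⟨ F.+-congˡ eq ⟩
      E.to i +ᶠ 0#           ≈⟨ F.+-identityʳ _ ⟩
      E.to i                 ∎)) (E.strictlyInverseʳ i)

    shift₁ : Permutation′ (2 ^ n)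
    shift₁ = permutation (shift 1#) (shift (-ᶠ 1#))
      (shift-shift (-ᶠ 1#) 1# (F.-‿inverseˡ 1#))
      (shift-shift 1# (-ᶠ 1#) (F.-‿inverseʳ 1#))

    size×1≈0 : (2 ^ n) ×ᶠ 1# ≈ 0#
    size×1≈0 = ∙-cancelˡ (sum E.to) _ _ (begin
      sum E.to +ᶠ ((2 ^ n) ×ᶠ 1#)             ≈⟨ F.+-congˡ (sum-replicate (2 ^ n)) ⟨
      sum E.to +ᶠ sum {2 ^ n} (λ _ → 1#)      ≈⟨ ∑-distrib-+ E.to (λ _ → 1#) ⟨
      sum (λ i → E.to i +ᶠ 1#)                ≈⟨ sum-cong-≋ (λ i → to-from (E.to i +ᶠ 1#)) ⟨
      sum (λ i → E.to (shift 1# i))           ≈⟨ sum-permute E.to shift₁ ⟨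
      sum E.to                                ≈⟨ F.+-identityʳ _ ⟨
      sum E.to +ᶠ 0#                          ∎)

    2×1≉0⇒2^j×1≉0 : ¬ 2 ×ᶠ 1# ≈ 0# → ∀ j → ¬ (2 ^ j) ×ᶠ 1# ≈ 0#
    2×1≉0⇒2^j×1≉0 2≉0 zero    eq = F.1≉0 (F.trans (F.sym (×-homo-1 1#)) eq)
    2×1≉0⇒2^j×1≉0 2≉0 (suc j) eq = 2×1≉0⇒2^j×1≉0 2≉0 j (begin
      t                   ≈⟨ F.*-identityˡ t ⟨
      1# *ᶠ t             ≈⟨ F.*-congʳ (F.trans (F.sym (proj₂ inv)) (F.*-comm _ _)) ⟩
      proj₁ inv *ᶠ two *ᶠ t    ≈⟨ F.*-assoc _ _ _ ⟩
      proj₁ inv *ᶠ (two *ᶠ t)  ≈⟨ F.*-congˡ (F.trans (F.sym (×1-homo-* 2 (2 ^ j))) eq) ⟩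
      proj₁ inv *ᶠ 0#          ≈⟨ F.zeroʳ _ ⟩
      0#                  ∎)
      where
      t two : Carrier
      t   = (2 ^ j) ×ᶠ 1#
      two = 2 ×ᶠ 1#
      inv : ∃[ y ] two *ᶠ y ≈ 1#
      inv = F.inverses two 2≉0

    two≈0 : 2 ×ᶠ 1# ≈ 0#
    two≈0 with E.from (2 ×ᶠ 1#) Fin.≟ E.from 0#
    ... | yes eq = F.trans (F.sym (to-from _)) (F.trans (E.to-cong eq) (to-from 0#))
    ... | no neq = contradiction size×1≈0 (2×1≉0⇒2^j×1≉0 (neq ∘ E.from-cong) n)

  char2 : ∀ x → x +ᶠ x ≈ 0#
  char2 x = begin
    x +ᶠ x                  ≈⟨ F.+-cong (F.*-identityʳ x) (F.*-identityʳ x) ⟨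
    x *ᶠ 1# +ᶠ x *ᶠ 1#      ≈⟨ F.distribˡ x 1# 1# ⟨
    x *ᶠ (1# +ᶠ 1#)         ≈⟨ F.*-congˡ (F.+-congˡ (F.+-identityʳ 1#)) ⟨
    x *ᶠ (2 ×ᶠ 1#)          ≈⟨ F.*-congˡ two≈0 ⟩
    x *ᶠ 0#                 ≈⟨ F.zeroʳ x ⟩
    0#                      ∎

  scale : Bool → Carrier → Carrier
  scale b x = if b then x else 0#

  private
    scale-cong : ∀ {b b′ x y} → b ≡ b′ → x ≈ y → scale b x ≈ scale b′ y
    scale-cong {true}  ≡.refl x≈y = x≈y
    scale-cong {false} ≡.refl x≈y = F.refl

    scale-distribʳ : ∀ x b b′ → scale (b xor b′) x ≈ scale b x +ᶠ scale b′ x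
    scale-distribʳ x true  true  = F.sym (char2 x)
    scale-distribʳ x true  false = F.sym (F.+-identityʳ x)
    scale-distribʳ x false b′    = F.sym (F.+-identityˡ _)

    scale-assoc : ∀ b b′ x → scale (b ∧ b′) x ≈ scale b (scale b′ x)
    scale-assoc true  b′ x = F.refl
    scale-assoc false b′ x = F.refl

    scale-zeroʳ : ∀ b → scale b 0# ≈ 0#
    scale-zeroʳ true  = F.refl
    scale-zeroʳ false = F.refl

    scale-distribˡ : ∀ b x y → scale b (x +ᶠ y) ≈ scale b x +ᶠ scale b y
    scale-distribˡ true  x y = F.refl
    scale-distribˡ false x y = F.sym (F.+-identityˡ 0#)

    isModuleFromLeft : Biased.IsModuleFromLeft 𝔽₂ _≈_ _+ᶠ_ 0# -ᶠ_ scale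
    isModuleFromLeft = record
      { isLeftModule = record
        { isLeftSemimodule = record
          { +ᴹ-isCommutativeMonoid = F.+-isCommutativeMonoid
          ; isPreleftSemimodule = record
            { *ₗ-cong      = scale-cong
            ; *ₗ-zeroˡ     = λ _ → F.refl
            ; *ₗ-distribʳ  = scale-distribʳ
            ; *ₗ-identityˡ = λ _ → F.refl
            ; *ₗ-assoc     = scale-assoc
            ; *ₗ-zeroʳ     = scale-zeroʳ
            ; *ₗ-distribˡ  = scale-distribˡ
            }
          }
        ; -ᴹ‿cong    = F.-‿cong
        ; -ᴹ‿inverse = F.-‿inverse
        }
      }

  vectorSpace : Module 𝔽₂ c ℓ
  vectorSpace = record { isModule = Biased.IsModuleFromLeft.isModule isModuleFromLeft }

2^n∸1-nonZero : ∀ n .{{_ : NonZero n}} → NonZero (2 ^ n ∸ 1)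
2^n∸1-nonZero (suc n) = >-nonZero (ℕ.m<n⇒0<n∸m (ℕ.*-mono-≤ (ℕ.≤-refl {2}) (ℕ.m^n>0 2 n)))

module Cyclotomic (n : ℕ) .{{_ : NonZero n}} where

  private instance
    modulus-nonZero : NonZero (2 ^ n ∸ 1)
    modulus-nonZero = 2^n∸1-nonZero n

  ℤ₂ₙ₋₁ : Set
  ℤ₂ₙ₋₁ = Fin (2 ^ n ∸ 1)

  open ℤmod (2 ^ n ∸ 1) {{modulus-nonZero}} public using (_+ₘ_; 0ₘ; neg; _-ₘ_) renaming (isGroup to ℤ₂ₙ₋₁-isGroup)

  coset : ℤ₂ₙ₋₁ → List ℤ₂ₙ₋₁
  coset s = map (λ i → (toℕ s * 2 ^ i) mod (2 ^ n ∸ 1)) (upTo n)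

  -- The library's `min` also takes the default value s into account; this
  -- is harmless since s is the element i = 0 of its own coset.
  ρ : ℤ₂ₙ₋₁ → ℤ₂ₙ₋₁
  ρ s = Extrema.min (Fin.≤-totalOrder (2 ^ n ∸ 1)) s (coset s)

  module Subspaces (F : FiniteField c ℓ (2 ^ n)) (α : FiniteField.Carrier F) where
    open FiniteField F using (Carrier; _≈_; _*ᶠ_; _^ᶠ_)

    exponents : Pred Carrier p → Pred ℤ₂ₙ₋₁ p
    exponents X e = (α ^ᶠ toℕ e) ∈ₚ X

    ρΔ : Pred Carrier p → Pred ℤ₂ₙ₋₁ p
    ρΔ X t = ∃[ x ] ∃[ y ] (x ∈ₚ exponents X × y ∈ₚ exponents X × x ≢ y × t ≡ ρ (x -ₘ y))

    CosetComplete : ℕ → Pred Carrier p → Set p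
    CosetComplete k X = HasSize (ρΔ X) ((2 ^ k ∸ 1) * (2 ^ k ∸ 2))

    Disjoint : Pred Carrier p → Pred Carrier p → Set p
    Disjoint X Y = ρΔ X ⊥ₚ ρΔ Y

    -- αʲ X^(2ˡ)
    translate : ℕ → ℕ → Pred Carrier (c ⊔ ℓ) → Pred Carrier (c ⊔ ℓ)
    translate j l X y = ∃[ x ] (x ∈ₚ X × y ≈ α ^ᶠ j *ᶠ x ^ᶠ (2 ^ l))

    orbits : ∀ {N} → (Fin N → Pred Carrier (c ⊔ ℓ)) → Pred (Pred Carrier (c ⊔ ℓ)) (c ⊔ ℓ)
    orbits {N} X B =
      Σ[ i ∈ Fin N ] Σ[ l ∈ Fin n ] Σ[ j ∈ ℤ₂ₙ₋₁ ] B ≐ translate (toℕ j) (toℕ l) (X i)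

{-# OPTIONS --safe #-}
-- The blocks are the sets 2ˡ·Eᵢ, where Eᵢ ⊆ ℤ₂ₙ₋₁ is the set of exponents of Xᵢ.
-- A difference d ≠ 0 occurs: the plane ⟨1, αᵈ⟩ lies in some αʲ Xᵢ^(2ˡ), and dividing
-- αᵈ by 1 cancels αʲ.  It occurs once: ρ is constant on cyclotomic cosets, so
-- disjointness determines i from ρ(d); coset completeness makes (x , y) ↦ ρ(x − y)
-- injective on the ordered pairs of Eᵢ by counting; and, n being prime, the cosets of
-- nonzero elements have full size n, which determines l.
module Submission where

open import Defs
open import Algebra.Bundles using (Group)
open import Algebra.Module.Bundles using (Module)
import Algebra.Properties.CommutativeMonoid.Sum as Sum
import Algebra.Properties.Group as GroupProperties
import Algebra.Properties.Semiring.Exp as Exp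
open import Algebra.Structures using (IsGroup)
open import Data.Bool.Base using (Bool; true; false; if_then_else_; _xor_)
open import Data.Fin.Base using (Fin; zero; suc; toℕ) renaming (_≤_ to _≤ᶠ_)
import Data.Fin.Properties as Fin
open import Data.Fin.Subset as Subset using (Subset; ∣_∣)
open import Data.List.Base using (List; []; _∷_; _++_; map; length; filter; upTo; allFin; tabulate; cartesianProduct; cartesianProductWith)
import Data.List.Extrema as Extrema
open import Data.List.Membership.Propositional using (_∈_)
open import Data.List.Membership.Propositional.Properties
open import Data.List.Properties using (length-map; length-++; length-++-sucʳ; length-tabulate; length-upTo)
open import Data.List.Relation.Binary.Subset.Propositional using (_⊆_)
open import Data.List.Relation.Unary.All as All using (All; []; _∷_)
open import Data.List.Relation.Unary.AllPairs using ([]; _∷_)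
open import Data.List.Relation.Unary.Any using (here; there)
open import Data.List.Relation.Unary.Unique.Propositional using (Unique)
import Data.List.Relation.Unary.Unique.Propositional.Properties as Unique
open import Data.Nat.Base using (ℕ; zero; suc; _+_; _*_; _∸_; _^_; _≤_; _<_; _%_; _/_; s≤s; z≤n; NonZero; >-nonZero)
open import Data.Nat.Coprimality using (prime⇒coprime; coprime-Bézout)
open import Data.Nat.DivMod
open import Data.Nat.GCD using (module Bézout)
open import Data.Nat.Primality using (Prime; prime⇒nonZero)
import Data.Nat.Properties as ℕ
open import Data.Product.Base using (∃-syntax; _×_; _,_; proj₁; proj₂)
open import Data.Product.Properties using (≡-dec)
open import Data.Sum.Base using (_⊎_; inj₁; inj₂)
open import Data.Sum.Properties using (inj₁-injective; inj₂-injective)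
import Data.Vec.Base as Vec
open import Data.Vec.Properties using (lookup∘tabulate; tabulate∘lookup; tabulate-cong)
open import Function.Base using (_∘_; id; case_of_)
open import Function.Bundles using (Equivalence; Inverse; mk⇔)
open import Level using (Level; _⊔_; Lift; lift; lower)
open import Relation.Binary.Definitions using (DecidableEquality; tri<; tri≈; tri>)
open import Relation.Binary.PropositionalEquality using (_≡_; _≢_; refl; sym; trans; cong; cong₂; subst; module ≡-Reasoning)
import Relation.Binary.Reasoning.Setoid as ≈-Reasoning
open import Relation.Nullary using (¬_; yes; no; does; contradiction)
open import Relation.Nullary.Decidable using (dec-true; dec-false; decidable-stable)
open import Relation.Unary using (Pred; Decidable)

-- `IsPrimitive` only says that every nonzero element is some natural power of α. Exponents can live
-- in ℤ modulo 2ⁿ - 1 only once α is known to have exactly this order: a pigeonhole argument gives a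
-- positive exponent r ≤ 2ⁿ - 1 with αʳ = 1, and counting the field elements shows that no smaller
-- positive exponent works. The subspaces are bare predicates, on which nothing can be counted or
-- decided directly. A basis turns each into a duplicate-free list of 2ᵏ elements, hence its
-- exponents into one of length 2ᵏ - 1, and all counting becomes a comparison of lengths.
-- Multiplicity 1 refers to triples (block , x , y), so a difference must pin down the block as well
-- as the pair, and different indices (i , l) must give different sets. Both follow from the single
-- fact that a nonzero difference determines the index and the pair.

private
  variable
    a b c ℓ p : Level
    A : Set a
    B : Set b
    C : Set c

-- Counting with duplicate-free lists.

∈-remove : ∀ {x y : A} ps {qs} → y ∈ ps ++ x ∷ qs → y ≢ x → y ∈ ps ++ qs
∈-remove ps y∈ y≢x with ∈-++⁻ ps y∈
... | inj₁ y∈ps         = ∈-++⁺ˡ y∈ps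
... | inj₂ (here y≡x)   = contradiction y≡x y≢x
... | inj₂ (there y∈qs) = ∈-++⁺ʳ ps y∈qs

unique⊆⇒length≤ : ∀ {xs ys : List A} → Unique xs → xs ⊆ ys → length xs ≤ length ys
unique⊆⇒length≤ {xs = []}     _          _     = z≤n
unique⊆⇒length≤ {xs = x ∷ xs} (x∉ ∷ uxs) xs⊆ys
  with ps , qs , refl ← ∈-∃++ (xs⊆ys (here refl)) =
  subst (suc (length xs) ≤_) (sym (length-++-sucʳ ps x qs))
    (s≤s (unique⊆⇒length≤ uxs λ y∈ →
      ∈-remove ps (xs⊆ys (there y∈)) (λ y≡x → All.lookup x∉ y∈ (sym y≡x))))

unique-length : ∀ {xs ys : List A} → Unique xs → Unique ys → xs ⊆ ys → ys ⊆ xs → length xs ≡ length ys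
unique-length uxs uys xs⊆ys ys⊆xs = ℕ.≤-antisym (unique⊆⇒length≤ uxs xs⊆ys) (unique⊆⇒length≤ uys ys⊆xs)

-- If f x ≡ f y with x ≢ y, then ys is already covered by xs without x.
covering⇒injective : DecidableEquality A → (f : A → B) {xs : List A} {ys : List B} →
  Unique ys → length xs ≤ length ys → ys ⊆ map f xs →
  ∀ {x y} → x ∈ xs → y ∈ xs → f x ≡ f y → x ≡ y
covering⇒injective _≟_ f {xs} {ys} uys xs≤ys ys⊆fxs {x} {y} x∈ y∈ fx≡fy
  = decidable-stable (x ≟ y) λ x≢y → absurd x≢y (∈-∃++ x∈)
  where
  absurd : x ≢ y → ¬ (∃[ ps ] ∃[ qs ] xs ≡ ps ++ x ∷ qs)
  absurd x≢y (ps , qs , refl) = ℕ.<-irrefl refl (ℕ.≤-trans smaller xs≤ys)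
    where
    covered : ys ⊆ map f (ps ++ qs)
    covered z∈ with ∈-map⁻ f (ys⊆fxs z∈)
    ... | w , w∈ , refl with w ≟ x
    ... | yes refl = subst (_∈ map f (ps ++ qs)) (sym fx≡fy) (∈-map⁺ f (∈-remove ps y∈ (x≢y ∘ sym)))
    ... | no w≢x   = ∈-map⁺ f (∈-remove ps w∈ w≢x)
    smaller : length ys < length (ps ++ x ∷ qs)
    smaller = begin-strict
      length ys                    ≤⟨ unique⊆⇒length≤ uys covered ⟩
      length (map f (ps ++ qs))    ≡⟨ length-map f (ps ++ qs) ⟩
      length (ps ++ qs)            <⟨ ℕ.n<1+n _ ⟩
      suc (length (ps ++ qs))      ≡⟨ length-++-sucʳ ps x qs ⟨
      length (ps ++ x ∷ qs)        ∎
      where open ℕ.≤-Reasoning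

length-cartesianProductWith : ∀ (f : A → B → C) xs ys →
  length (cartesianProductWith f xs ys) ≡ length xs * length ys
length-cartesianProductWith f []       ys = refl
length-cartesianProductWith f (x ∷ xs) ys = trans (length-++ (map (f x) ys))
  (cong₂ _+_ (length-map (f x) ys) (length-cartesianProductWith f xs ys))

-- Coordinate vectors are `Vec`s rather than functions `Fin k → Bool`: without function
-- extensionality, only for the former is propositional equality, and hence `Unique`, the intended
-- notion.
bitVectors : ∀ k → List (Vec.Vec Bool k)
bitVectors zero    = Vec.[] ∷ []
bitVectors (suc k) = cartesianProductWith Vec._∷_ (true ∷ false ∷ []) (bitVectors k)

bitVectors-unique : ∀ k → Unique (bitVectors k)
bitVectors-unique zero    = [] ∷ []
bitVectors-unique (suc k) = Unique.cartesianProductWith⁺ Vec._∷_ ∷-injective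
  (((λ ()) ∷ []) ∷ [] ∷ []) (bitVectors-unique k)
  where open import Data.Vec.Properties using (∷-injective)

length-bitVectors : ∀ k → length (bitVectors k) ≡ 2 ^ k
length-bitVectors zero    = refl
length-bitVectors (suc k) = trans
  (length-cartesianProductWith Vec._∷_ (true ∷ false ∷ []) (bitVectors k))
  (cong (2 *_) (length-bitVectors k))

∈-bitVectors : ∀ {k} (v : Vec.Vec Bool k) → v ∈ bitVectors k
∈-bitVectors Vec.[]            = here refl
∈-bitVectors (true Vec.∷ v)  = ∈-cartesianProductWith⁺ Vec._∷_ {xs = true ∷ false ∷ []} (here refl) (∈-bitVectors v)
∈-bitVectors (false Vec.∷ v) = ∈-cartesianProductWith⁺ Vec._∷_ {xs = true ∷ false ∷ []} (there (here refl)) (∈-bitVectors v)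

-- Subsets of a finite set given by lists.

module _ {m : ℕ} where
  open import Data.List.Membership.DecPropositional (Fin._≟_ {m}) using (_∈?_)
  open import Data.Vec.Properties using (lookup⇒[]=; []=⇒lookup)

  fromList : List (Fin m) → Subset m
  fromList xs = Vec.tabulate (λ x → does (x ∈? xs))

  ∈-fromList⁺ : ∀ {x xs} → x ∈ xs → x Subset.∈ fromList xs
  ∈-fromList⁺ {x} {xs} x∈ = lookup⇒[]= x _ (trans (lookup∘tabulate _ x) (dec-true (x ∈? xs) x∈))

  ∈-fromList⁻ : ∀ {x xs} → x Subset.∈ fromList xs → x ∈ xs
  ∈-fromList⁻ {x} {xs} x∈ with x ∈? xs | trans (sym (lookup∘tabulate (λ x → does (x ∈? xs)) x)) ([]=⇒lookup x∈)
  ... | yes x∈xs | _ = x∈xs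
  ... | no _     | ()

  -- An arbitrary `f` lets the induction on r pass to `f ∘ suc`; the case of interest is `f = id`.
  ∣tabulate∣ : ∀ {r} {P : Pred (Fin m) p} (P? : Decidable P) (f : Fin r → Fin m) →
    ∣ Vec.tabulate (does ∘ P? ∘ f) ∣ ≡ length (filter P? (tabulate f))
  ∣tabulate∣ {r = zero}  P? f = refl
  ∣tabulate∣ {r = suc r} P? f with does (P? (f zero))
  ... | true  = cong suc (∣tabulate∣ P? (f ∘ suc))
  ... | false = ∣tabulate∣ P? (f ∘ suc)

  ∣fromList∣ : ∀ {xs} → Unique xs → ∣ fromList xs ∣ ≡ length xs
  ∣fromList∣ {xs} uxs = trans (∣tabulate∣ (_∈? xs) id)
    (unique-length (Unique.filter⁺ (_∈? xs) (Unique.allFin⁺ m)) uxs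
      (proj₂ ∘ ∈-filter⁻ (_∈? xs) {xs = allFin m}) (∈-filter⁺ (_∈? xs) (∈-allFin _)))

-- Multiplication by powers of 2 modulo 2ⁿ - 1, and cyclotomic cosets.

module Dilation (n : ℕ) .{{_ : NonZero n}} where

  private
    m = 2 ^ n ∸ 1
    instance
      m-nonZero : NonZero (2 ^ n ∸ 1)
      m-nonZero = 2^n∸1-nonZero n

  open Cyclotomic n
  open ℤmod (2 ^ n ∸ 1) hiding (_+ₘ_; 0ₘ; neg; _-ₘ_) public

  ℤ-group : Group _ _
  ℤ-group = record { isGroup = ℤ₂ₙ₋₁-isGroup }

  open GroupProperties ℤ-group using (x≈z//y; identityʳ-unique; x∙y⁻¹≈ε⇒x≈y) public

  2^n≡1+m : 2 ^ n ≡ 1 + (2 ^ n ∸ 1)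
  2^n≡1+m = sym (ℕ.m+[n∸m]≡n (ℕ.m^n>0 2 n))

  -- The effect on exponents of the Frobenius power x ↦ x^(2ˡ). The formula is that of the entries
  -- of `coset s`, which are therefore the `dilate i s` for i < n.
  dilate : ℕ → ℤ₂ₙ₋₁ → ℤ₂ₙ₋₁
  dilate l s = (toℕ s * 2 ^ l) mod (2 ^ n ∸ 1)

  mod-*ˡ : ∀ x y → (toℕ (x mod (2 ^ n ∸ 1)) * y) mod (2 ^ n ∸ 1) ≡ (x * y) mod (2 ^ n ∸ 1)
  mod-*ˡ x y = mod-cong (begin
    (toℕ (x mod m) * y) % m        ≡⟨ cong (λ z → (z * y) % m) (toℕ-mod x) ⟩
    (x % m * y) % m                ≡⟨ %-distribˡ-* (x % m) y m ⟩
    ((x % m % m) * (y % m)) % m    ≡⟨ cong (λ z → (z * (y % m)) % m) (m%n%n≡m%n x m) ⟩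
    ((x % m) * (y % m)) % m        ≡⟨ %-distribˡ-* x y m ⟨
    (x * y) % m                    ∎)
    where open ≡-Reasoning

  mod-+ : ∀ x y → (x + y) mod (2 ^ n ∸ 1) ≡ x mod (2 ^ n ∸ 1) +ₘ y mod (2 ^ n ∸ 1)
  mod-+ x y = mod-cong (trans (%-distribˡ-+ x y m)
    (cong₂ (λ u v → (u + v) % m) (sym (toℕ-mod x)) (sym (toℕ-mod y))))

  dilate-dilate : ∀ l l′ s → dilate l (dilate l′ s) ≡ dilate (l′ + l) s
  dilate-dilate l l′ s = trans (mod-*ˡ (toℕ s * 2 ^ l′) (2 ^ l)) (cong (_mod m)
    (trans (ℕ.*-assoc (toℕ s) _ _) (cong (toℕ s *_) (sym (ℕ.^-distribˡ-+-* 2 l′ l)))))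

  dilate-0 : ∀ s → dilate 0 s ≡ s
  dilate-0 s = trans (cong (_mod m) (ℕ.*-identityʳ (toℕ s))) (mod-toℕ s)

  -- Since 2ⁿ = 1 + (2ⁿ - 1), multiplying by 2ⁿ adds a multiple of the modulus.
  dilate-n : ∀ s → dilate n s ≡ s
  dilate-n s = trans (mod-cong (begin
    (toℕ s * 2 ^ n) % m          ≡⟨ cong (λ z → (toℕ s * z) % m) 2^n≡1+m ⟩
    (toℕ s * suc m) % m          ≡⟨ cong (_% m) (ℕ.*-suc (toℕ s) m) ⟩
    (toℕ s + toℕ s * m) % m      ≡⟨ [m+kn]%n≡m%n (toℕ s) (toℕ s) m ⟩
    toℕ s % m                    ∎)) (mod-toℕ s)
    where open ≡-Reasoning

  dilate-fixed-* : ∀ {s l} → dilate l s ≡ s → ∀ x → dilate (x * l) s ≡ s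
  dilate-fixed-* {s} fixed zero    = dilate-0 s
  dilate-fixed-* {s} {l} fixed (suc x) = begin
    dilate (l + x * l) s        ≡⟨ dilate-dilate (x * l) l s ⟨
    dilate (x * l) (dilate l s) ≡⟨ cong (dilate (x * l)) fixed ⟩
    dilate (x * l) s            ≡⟨ dilate-fixed-* fixed x ⟩
    s                           ∎
    where open ≡-Reasoning

  -- The witness plays the role of -l modulo n: as n ≥ 1, the subtraction is not truncated, and
  -- adding l gives the multiple l · n of n.
  dilate-inverse : ∀ l s → ∃[ l′ ] dilate l′ (dilate l s) ≡ s
  dilate-inverse l s = l * n ∸ l , (begin
    dilate (l * n ∸ l) (dilate l s)  ≡⟨ dilate-dilate (l * n ∸ l) l s ⟩
    dilate (l + (l * n ∸ l)) s       ≡⟨ cong (λ z → dilate z s) (ℕ.m+[n∸m]≡n (ℕ.m≤m*n l n)) ⟩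
    dilate (l * n) s                 ≡⟨ dilate-fixed-* (dilate-n s) l ⟩
    s                                ∎)
    where open ≡-Reasoning

  dilate-+ : ∀ l x y → dilate l (x +ₘ y) ≡ dilate l x +ₘ dilate l y
  dilate-+ l x y = begin
    dilate l (x +ₘ y)                          ≡⟨ mod-*ˡ (toℕ x + toℕ y) (2 ^ l) ⟩
    ((toℕ x + toℕ y) * 2 ^ l) mod m            ≡⟨ cong (_mod m) (ℕ.*-distribʳ-+ (2 ^ l) (toℕ x) (toℕ y)) ⟩
    (toℕ x * 2 ^ l + toℕ y * 2 ^ l) mod m      ≡⟨ mod-+ (toℕ x * 2 ^ l) (toℕ y * 2 ^ l) ⟩
    dilate l x +ₘ dilate l y                   ∎
    where open ≡-Reasoning

  dilate-- : ∀ l x y → dilate l (x -ₘ y) ≡ dilate l x -ₘ dilate l y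
  dilate-- l x y = x≈z//y _ _ _ (trans (sym (dilate-+ l (x -ₘ y) y)) (cong (dilate l) (//-rightDividesˡ y x)))
    where open GroupProperties ℤ-group using (//-rightDividesˡ)

  dilate-injective : ∀ l {x y} → dilate l x ≡ dilate l y → x ≡ y
  dilate-injective l {x} {y} eq = trans (sym (undo x)) (trans (cong (dilate (l * n ∸ l)) eq) (undo y))
    where undo = proj₂ ∘ dilate-inverse l

  dilate-1 : ∀ s → dilate 1 s ≡ s +ₘ s
  dilate-1 s = cong (_mod m) (trans (ℕ.*-comm (toℕ s) 2) (cong (toℕ s +_) (ℕ.+-identityʳ (toℕ s))))

  open Extrema (Fin.≤-totalOrder (2 ^ n ∸ 1)) using (min≤xs; v≤min⁺)

  -- The coset lists only exponents below n, so l is replaced by `l % n`; the discarded multiple of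
  -- n acts trivially.
  ρ≤dilate : ∀ l s → ρ s ≤ᶠ dilate l s
  ρ≤dilate l s = subst (ρ s ≤ᶠ_) reduce
    (All.lookup (min≤xs s (coset s)) (∈-map⁺ (λ i → dilate i s) (∈-upTo⁺ (m%n<n l n))))
    where
    open ≡-Reasoning
    reduce : dilate (l % n) s ≡ dilate l s
    reduce = begin
      dilate (l % n) s                          ≡⟨ cong (dilate (l % n)) (dilate-fixed-* (dilate-n s) (l / n)) ⟨
      dilate (l % n) (dilate (l / n * n) s)     ≡⟨ dilate-dilate (l % n) (l / n * n) s ⟩
      dilate (l / n * n + l % n) s              ≡⟨ cong (λ z → dilate z s) (trans (ℕ.+-comm (l / n * n) _) (sym (m≡m%n+[m/n]*n l n))) ⟩
      dilate l s                                ∎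

  ρ≤ρ-dilate : ∀ l s → ρ s ≤ᶠ ρ (dilate l s)
  ρ≤ρ-dilate l s = v≤min⁺ (ρ≤dilate l s) (All.tabulate λ t∈ → below (∈-map⁻ (λ i → dilate i (dilate l s)) t∈))
    where
    below : ∀ {t} → ∃[ i ] (i ∈ upTo n × t ≡ dilate i (dilate l s)) → ρ s ≤ᶠ t
    below (i , _ , refl) = subst (ρ s ≤ᶠ_) (sym (dilate-dilate i l s)) (ρ≤dilate (l + i) s)

  -- Dilations are invertible, so the inequality `ρ≤ρ-dilate`, applied also to the inverse dilation,
  -- gives both directions.
  ρ-dilate : ∀ l s → ρ (dilate l s) ≡ ρ s
  ρ-dilate l s with l′ , undo ← dilate-inverse l s = Fin.≤-antisym
    (subst (ρ (dilate l s) ≤ᶠ_) (cong ρ undo) (ρ≤ρ-dilate l′ (dilate l s)))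
    (ρ≤ρ-dilate l s)

  dilate≡⇒ρ≡ : ∀ l l′ {s s′} → dilate l s ≡ dilate l′ s′ → ρ s ≡ ρ s′
  dilate≡⇒ρ≡ l l′ {s} {s′} eq = trans (sym (ρ-dilate l s)) (trans (cong ρ eq) (ρ-dilate l′ s′))

  -- The stabiliser of s in ℤₙ contains l and n, hence 1; and 2s = s forces s = 0.
  dilate-fixed⇒0 : Prime n → ∀ {l s} → 0 < l → l < n → dilate l s ≡ s → s ≡ 0ₘ
  dilate-fixed⇒0 n-prime {l} {s} 0<l l<n fixed = identityʳ-unique s s (trans (sym (dilate-1 s)) dilate1)
    where
    combine : ∀ {u v} → dilate u s ≡ s → dilate v s ≡ s → 1 + v ≡ u → dilate 1 s ≡ s
    combine {u} {v} du dv eq = begin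
      dilate 1 s               ≡⟨ cong (dilate 1) dv ⟨
      dilate 1 (dilate v s)    ≡⟨ dilate-dilate 1 v s ⟩
      dilate (v + 1) s         ≡⟨ cong (λ z → dilate z s) (trans (ℕ.+-comm v 1) eq) ⟩
      dilate u s               ≡⟨ du ⟩
      s                        ∎
      where open ≡-Reasoning
    dilate1 : dilate 1 s ≡ s
    dilate1 with coprime-Bézout (prime⇒coprime n-prime {{>-nonZero 0<l}} l<n)
    ... | Bézout.+- x y eq = combine (dilate-fixed-* (dilate-n s) x) (dilate-fixed-* fixed y) eq
    ... | Bézout.-+ x y eq = combine (dilate-fixed-* fixed y) (dilate-fixed-* (dilate-n s) x) eq

  private
    -- Cancelling the smaller dilation leaves s fixed by l′ - l, which lies strictly between 0 and
    -- n.
    dilate-<⇒0 : Prime n → ∀ {l l′ s} → l < l′ → l′ < n → dilate l s ≡ dilate l′ s → s ≡ 0ₘ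
    dilate-<⇒0 n-prime {l} {l′} {s} l<l′ l′<n eq = dilate-fixed⇒0 n-prime (ℕ.m<n⇒0<n∸m l<l′)
      (ℕ.≤-<-trans (ℕ.m∸n≤m l′ l) l′<n) (dilate-injective l (begin
        dilate l (dilate (l′ ∸ l) s)  ≡⟨ dilate-dilate l (l′ ∸ l) s ⟩
        dilate (l′ ∸ l + l) s         ≡⟨ cong (λ z → dilate z s) (ℕ.m∸n+n≡m (ℕ.<⇒≤ l<l′)) ⟩
        dilate l′ s                   ≡⟨ eq ⟨
        dilate l s                    ∎))
      where open ≡-Reasoning

  dilate-exponent-injective : Prime n → ∀ {s} → s ≢ 0ₘ → ∀ {l l′} → l < n → l′ < n →
    dilate l s ≡ dilate l′ s → l ≡ l′
  dilate-exponent-injective n-prime s≢0 {l} {l′} l<n l′<n eq with ℕ.<-cmp l l′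
  ... | tri< l<l′ _ _ = contradiction (dilate-<⇒0 n-prime l<l′ l′<n eq) s≢0
  ... | tri≈ _ l≡l′ _ = l≡l′
  ... | tri> _ _ l′<l = contradiction (dilate-<⇒0 n-prime l′<l l<n (sym eq)) s≢0

-- The order of α and discrete logarithms.

module Logarithm {c ℓ} (n : ℕ) .{{_ : NonZero n}} (F : FiniteField c ℓ (2 ^ n))
  (α : FiniteField.Carrier F) (α-primitive : FiniteField.IsPrimitive F α) where

  private
    m = 2 ^ n ∸ 1
    instance
      m-nonZero : NonZero (2 ^ n ∸ 1)
      m-nonZero = 2^n∸1-nonZero n
    module F = FiniteField F
    module E = Inverse F.enumeration
    module V = Module (vectorSpace n F)

  open Cyclotomic n
  open Subspaces F α
  open Dilation n
  open F using (Carrier; _≈_; _+ᶠ_; _*ᶠ_; _^ᶠ_; 0#; 1#)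
  open Exp F.semiring using (^-homo-*; ^-assocʳ; ^-congˡ)
  open import Data.List.Membership.DecPropositional (Fin._≟_ {2 ^ n}) using (_∈?_)

  from-injective : ∀ {x y} → E.from x ≡ E.from y → x ≈ y
  from-injective {x} {y} eq = F.trans (F.sym (E.strictlyInverseˡ x))
    (F.trans (E.to-cong eq) (E.strictlyInverseˡ y))

  α≉0 : ¬ α ≈ 0#
  α≉0 = proj₁ α-primitive

  α⁻¹ : Carrier
  α⁻¹ = proj₁ (F.inverses α α≉0)

  α-cancelˡ : ∀ {x y} → α *ᶠ x ≈ α *ᶠ y → x ≈ y
  α-cancelˡ {x} {y} eq = F.trans (F.sym (undo x)) (F.trans (F.*-congˡ eq) (undo y))
    where
    undo : ∀ z → α⁻¹ *ᶠ (α *ᶠ z) ≈ z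
    undo z = F.trans (F.sym (F.*-assoc _ _ _)) (F.trans
      (F.*-congʳ (F.trans (F.*-comm _ _) (proj₂ (F.inverses α α≉0)))) (F.*-identityˡ z))

  α^-cancelˡ : ∀ i {x y} → α ^ᶠ i *ᶠ x ≈ α ^ᶠ i *ᶠ y → x ≈ y
  α^-cancelˡ zero    eq = F.trans (F.sym (F.*-identityˡ _)) (F.trans eq (F.*-identityˡ _))
  α^-cancelˡ (suc i) eq = α^-cancelˡ i (α-cancelˡ (F.trans (F.sym (F.*-assoc _ _ _)) (F.trans eq (F.*-assoc _ _ _))))

  α^≉0 : ∀ i → ¬ α ^ᶠ i ≈ 0#
  α^≉0 i eq = F.1≉0 (α^-cancelˡ i (F.trans (F.*-identityʳ _) (F.trans eq (F.sym (F.zeroʳ _)))))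

  α^-≈⇒α^∸≈1 : ∀ {i j} → i ≤ j → α ^ᶠ i ≈ α ^ᶠ j → α ^ᶠ (j ∸ i) ≈ 1#
  α^-≈⇒α^∸≈1 {i} {j} i≤j eq = α^-cancelˡ i (begin
    α ^ᶠ i *ᶠ α ^ᶠ (j ∸ i)  ≈⟨ ^-homo-* α i (j ∸ i) ⟨
    α ^ᶠ (i + (j ∸ i))      ≡⟨ cong (α ^ᶠ_) (ℕ.m+[n∸m]≡n i≤j) ⟩
    α ^ᶠ j                  ≈⟨ eq ⟨
    α ^ᶠ i                  ≈⟨ F.*-identityʳ _ ⟨
    α ^ᶠ i *ᶠ 1#            ∎)
    where open ≈-Reasoning F.setoid

  1^ : ∀ i → 1# ^ᶠ i ≈ 1#
  1^ zero    = F.refl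
  1^ (suc i) = F.trans (F.*-identityˡ _) (1^ i)

  α^-% : ∀ r .{{_ : NonZero r}} → α ^ᶠ r ≈ 1# → ∀ i → α ^ᶠ i ≈ α ^ᶠ (i % r)
  α^-% r eq i = begin
    α ^ᶠ i                                  ≡⟨ cong (α ^ᶠ_) (m≡m%n+[m/n]*n i r) ⟩
    α ^ᶠ (i % r + i / r * r)                ≈⟨ ^-homo-* α (i % r) (i / r * r) ⟩
    α ^ᶠ (i % r) *ᶠ α ^ᶠ (i / r * r)        ≡⟨ cong (λ z → α ^ᶠ (i % r) *ᶠ α ^ᶠ z) (ℕ.*-comm (i / r) r) ⟩
    α ^ᶠ (i % r) *ᶠ α ^ᶠ (r * (i / r))      ≈⟨ F.*-congˡ (^-assocʳ α r (i / r)) ⟨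
    α ^ᶠ (i % r) *ᶠ (α ^ᶠ r) ^ᶠ (i / r)     ≈⟨ F.*-congˡ (F.trans (^-congˡ (i / r) eq) (1^ (i / r))) ⟩
    α ^ᶠ (i % r) *ᶠ 1#                      ≈⟨ F.*-identityʳ _ ⟩
    α ^ᶠ (i % r)                            ∎
    where open ≈-Reasoning F.setoid

  -- If αʳ = 1, then 0 and the r powers α⁰, ..., αʳ⁻¹ exhaust the field, so 2ⁿ ≤ 1 + r.
  order≥ : ∀ r .{{_ : NonZero r}} → α ^ᶠ r ≈ 1# → 2 ^ n ∸ 1 ≤ r
  order≥ r eq = ℕ.∸-monoˡ-≤ 1 (begin
    2 ^ n                    ≡⟨ length-tabulate id ⟨
    length (allFin (2 ^ n))  ≤⟨ unique⊆⇒length≤ (Unique.allFin⁺ (2 ^ n)) covered ⟩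
    length (E.from 0# ∷ map (λ i → E.from (α ^ᶠ i)) (upTo r)) ≡⟨ cong suc (trans (length-map _ (upTo r)) (length-upTo r)) ⟩
    suc r                    ∎)
    where
    open ℕ.≤-Reasoning
    covered : allFin (2 ^ n) ⊆ E.from 0# ∷ map (λ i → E.from (α ^ᶠ i)) (upTo r)
    covered {x} _ with x Fin.≟ E.from 0#
    ... | yes eq₀ = here eq₀
    ... | no neq
      with i , eqᵢ ← proj₂ α-primitive (E.to x)
                       (λ x≈0 → neq (trans (sym (E.strictlyInverseʳ x)) (E.from-cong x≈0)))
      = there (subst (_∈ _) (trans (E.from-cong (F.trans (F.sym (α^-% r eq i)) (F.sym eqᵢ))) (E.strictlyInverseʳ x))
          (∈-map⁺ (λ i → E.from (α ^ᶠ i)) (∈-upTo⁺ (m%n<n i r))))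

  private
    -- Including 0 sharpens the pigeonhole bound by one: only the exponents 0, ..., 2ⁿ - 1 are then
    -- needed to have 2ⁿ + 1 values. No power of α is 0, so two of these powers collide, and their
    -- exponents differ by at most 2ⁿ - 1, matching `order≥`.
    0-and-powers : Fin (suc (2 ^ n)) → Fin (2 ^ n)
    0-and-powers zero    = E.from 0#
    0-and-powers (suc i) = E.from (α ^ᶠ toℕ i)

  ∃-order≤ : ∃[ r ] (0 < r × r ≤ 2 ^ n ∸ 1 × α ^ᶠ r ≈ 1#)
  ∃-order≤ with Fin.pigeonhole (ℕ.n<1+n (2 ^ n)) 0-and-powers
  ... | zero  , suc j , _         , eq = contradiction (F.sym (from-injective eq)) (α^≉0 (toℕ j))
  ... | suc i , suc j , s≤s i<j , eq = toℕ j ∸ toℕ i , ℕ.m<n⇒0<n∸m i<j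
      , ℕ.≤-trans (ℕ.m∸n≤m (toℕ j) (toℕ i)) (ℕ.∸-monoˡ-≤ 1 (Fin.toℕ<n j))
      , α^-≈⇒α^∸≈1 (ℕ.<⇒≤ i<j) (from-injective eq)

  α^m≈1 : α ^ᶠ (2 ^ n ∸ 1) ≈ 1#
  α^m≈1 with r , 0<r , r≤m , eq ← ∃-order≤ =
    subst (λ z → α ^ᶠ z ≈ 1#) (ℕ.≤-antisym r≤m (order≥ r {{>-nonZero 0<r}} eq)) eq

  α^-mod : ∀ i → α ^ᶠ toℕ (i mod (2 ^ n ∸ 1)) ≈ α ^ᶠ i
  α^-mod i = F.trans (F.reflexive (cong (α ^ᶠ_) (toℕ-mod i))) (F.sym (α^-% m α^m≈1 i))

  private
    α^-≉ : ∀ {i j} → i < j → j < 2 ^ n ∸ 1 → ¬ α ^ᶠ i ≈ α ^ᶠ j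
    α^-≉ {i} {j} i<j j<m eq = ℕ.<-irrefl refl (ℕ.≤-<-trans
      (order≥ (j ∸ i) {{>-nonZero (ℕ.m<n⇒0<n∸m i<j)}} (α^-≈⇒α^∸≈1 (ℕ.<⇒≤ i<j) eq))
      (ℕ.≤-<-trans (ℕ.m∸n≤m j i) j<m))

  α^-injective : ∀ {e e′ : ℤ₂ₙ₋₁} → α ^ᶠ toℕ e ≈ α ^ᶠ toℕ e′ → e ≡ e′
  α^-injective {e} {e′} eq with ℕ.<-cmp (toℕ e) (toℕ e′)
  ... | tri< lt _ _ = contradiction eq (α^-≉ lt (Fin.toℕ<n e′))
  ... | tri≈ _ e≡e′ _ = Fin.toℕ-injective e≡e′
  ... | tri> _ _ gt = contradiction (F.sym eq) (α^-≉ gt (Fin.toℕ<n e))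

  α^-≈⇒mod≡ : ∀ {i j} → α ^ᶠ i ≈ α ^ᶠ j → i mod (2 ^ n ∸ 1) ≡ j mod (2 ^ n ∸ 1)
  α^-≈⇒mod≡ {i} {j} eq = α^-injective (F.trans (α^-mod i) (F.trans eq (F.sym (α^-mod j))))

  1≈α^⇒≡0 : ∀ {d : ℤ₂ₙ₋₁} → 1# ≈ α ^ᶠ toℕ d → d ≡ 0ₘ
  1≈α^⇒≡0 {d} eq = trans (sym (mod-toℕ d)) (sym (α^-≈⇒mod≡ {0} {toℕ d} eq))

  ∃-log : ∀ {x} → ¬ x ≈ 0# → ∃[ e ] x ≈ α ^ᶠ toℕ {2 ^ n ∸ 1} e
  ∃-log {x} x≉0 with i , eq ← proj₂ α-primitive x x≉0 = i mod (2 ^ n ∸ 1) , F.trans eq (F.sym (α^-mod i))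

  -- Planes, and the exponents of a subspace over 𝔽₂.

  open Sum V.+ᴹ-commutativeMonoid using (sum; sum-cong-≋; ∑-distrib-+)

  linComb-xor : ∀ {r} (b b′ : Fin r → Bool) (v : Fin r → Carrier) →
    linComb (vectorSpace n F) (λ i → b i xor b′ i) v
      ≈ linComb (vectorSpace n F) b v +ᶠ linComb (vectorSpace n F) b′ v
  linComb-xor b b′ v = F.trans (sum-cong-≋ (λ i → V.*ₗ-distribʳ (v i) (b i) (b′ i)))
    (∑-distrib-+ (λ i → b i V.*ₗ v i) (λ i → b′ i V.*ₗ v i))

  module _ (x y : Carrier) where
    private
      generators : Fin 2 → Carrier
      generators zero    = x
      generators (suc _) = y

      bits : Bool → Bool → Fin 2 → Bool
      bits s t zero    = s
      bits s t (suc _) = t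

    -- `Lift` raises the span from level ℓ to c ⊔ ℓ, the level of the planes over which `covers`
    -- quantifies.
    plane : Pred Carrier (c ⊔ ℓ)
    plane z = Lift c (∃[ b ] z ≈ linComb (vectorSpace n F) b generators)

    x∈plane : plane x
    x∈plane = lift (bits true false , F.sym (F.trans (F.+-congˡ (F.+-identityʳ 0#)) (F.+-identityʳ x)))

    y∈plane : plane y
    y∈plane = lift (bits false true , F.sym (F.trans (F.+-identityˡ _) (F.+-identityʳ y)))

    -- Over 𝔽₂ the nontrivial combinations are x, y and x + y, one for each hypothesis; in
    -- characteristic 2 the last vanishes exactly when x ≈ y.
    plane-isSubspaceOfDim : ¬ x ≈ 0# → ¬ y ≈ 0# → ¬ x ≈ y → IsSubspaceOfDim (vectorSpace n F) 2 plane
    plane-isSubspaceOfDim x≉0 y≉0 x≉y = record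
      { isSubspace = record
        { resp      = λ { z≈z′ (lift (b , eq)) → lift (b , F.trans (F.sym z≈z′) eq) }
        ; 0-closed  = zero∈
        ; +-closed  = λ { (lift (b , eq)) (lift (b′ , eq′)) → lift ((λ i → b i xor b′ i)
                      , F.trans (F.+-cong eq eq′) (F.sym (linComb-xor b b′ generators))) }
        ; *ₗ-closed = λ { true z∈ → z∈ ; false _ → zero∈ }
        }
      ; basis = generators
      ; isBasis = record
        { inside      = λ { zero → x∈plane ; (suc _) → y∈plane }
        ; independent = λ b eq → λ { zero → proj₁ (independent (b zero) (b (suc zero)) eq)
                                   ; (suc zero) → proj₂ (independent (b zero) (b (suc zero)) eq) }
        ; spanning    = lower
        }
      }
      where
      zero∈ : plane 0#
      zero∈ = lift (bits false false , F.sym (F.trans (F.+-identityˡ _) (F.+-identityˡ _)))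

      independent : ∀ s t → (s V.*ₗ x) +ᶠ ((t V.*ₗ y) +ᶠ 0#) ≈ 0# → s ≡ false × t ≡ false
      independent false false _  = refl , refl
      independent false true  eq = contradiction
        (F.trans (F.sym (F.trans (F.+-identityˡ _) (F.+-identityʳ y))) eq) y≉0
      independent true  false eq = contradiction
        (F.trans (F.sym (F.trans (F.+-congˡ (F.+-identityʳ 0#)) (F.+-identityʳ x))) eq) x≉0
      independent true  true  eq = contradiction
        (∙-cancelʳ y x y (F.trans (F.+-congˡ (F.sym (F.+-identityʳ y))) (F.trans eq (F.sym (char2 n F y))))) x≉y
        where open GroupProperties F.+-group using (∙-cancelʳ)

  module _ {X : Pred Carrier p} {k : ℕ} (dim : IsSubspaceOfDim (vectorSpace n F) k X) where
    open IsSubspaceOfDim dim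
    open IsSubspace isSubspace
    open IsBasis isBasis

    private
      comb : (Fin k → Bool) → Carrier
      comb b = linComb (vectorSpace n F) b basis

    comb-closed : ∀ b → X (comb b)
    comb-closed b = sum-closed (λ i → *ₗ-closed (b i) (inside i))
      where
      sum-closed : ∀ {r} {f : Fin r → Carrier} → (∀ i → X (f i)) → X (sum f)
      sum-closed {zero}  _  = 0-closed
      sum-closed {suc r} f∈ = +-closed (f∈ zero) (sum-closed (f∈ ∘ suc))

    comb-cong : ∀ {b b′} → (∀ i → b i ≡ b′ i) → comb b ≈ comb b′
    comb-cong eq = sum-cong-≋ (λ i → V.*ₗ-cong (eq i) F.refl)

    -- In characteristic 2 the pointwise `xor` gives the coordinates of the difference, to which
    -- independence applies.
    comb-injective : ∀ {b b′} → comb b ≈ comb b′ → ∀ i → b i ≡ b′ i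
    comb-injective {b} {b′} eq i = xor-false (b i) (b′ i) (independent (λ i → b i xor b′ i) (begin
      comb (λ i → b i xor b′ i)  ≈⟨ linComb-xor b b′ basis ⟩
      comb b +ᶠ comb b′          ≈⟨ F.+-congʳ eq ⟩
      comb b′ +ᶠ comb b′         ≈⟨ char2 n F (comb b′) ⟩
      0#                         ∎) i)
      where
      open ≈-Reasoning F.setoid
      xor-false : ∀ x y → x xor y ≡ false → x ≡ y
      xor-false true  true  _ = refl
      xor-false false false _ = refl

    -- Membership in `X` comes without a decision procedure. Running through all coordinate vectors
    -- lists `X` by indices in the enumeration of the field, where membership is decidable;
    -- `exponentList` filters by it.
    elements : List (Fin (2 ^ n))
    elements = map (λ v → E.from (comb (Vec.lookup v))) (bitVectors k)

    elements-unique : Unique elements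
    elements-unique = Unique.map⁺ (λ {v} {v′} eq → trans (sym (tabulate∘lookup v))
      (trans (tabulate-cong (comb-injective (from-injective eq))) (tabulate∘lookup v′))) (bitVectors-unique k)

    ∈-elements⁺ : ∀ {x} → X x → E.from x ∈ elements
    ∈-elements⁺ {x} x∈ with b , eq ← spanning x∈ = subst (_∈ elements)
      (E.from-cong (F.trans (comb-cong (lookup∘tabulate b)) (F.sym eq)))
      (∈-map⁺ _ (∈-bitVectors (Vec.tabulate b)))

    ∈-elements⁻ : ∀ {x} → E.from x ∈ elements → X x
    ∈-elements⁻ {x} x∈ with v , _ , eq ← ∈-map⁻ _ x∈ = resp (F.sym (from-injective eq)) (comb-closed _)

    exponentList : List ℤ₂ₙ₋₁
    exponentList = filter (λ e → E.from (α ^ᶠ toℕ e) ∈? elements) (allFin (2 ^ n ∸ 1))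

    exponentList-unique : Unique exponentList
    exponentList-unique = Unique.filter⁺ _ (Unique.allFin⁺ m)

    ∈-exponentList⁺ : ∀ {e} → exponents X e → e ∈ exponentList
    ∈-exponentList⁺ e∈ = ∈-filter⁺ _ (∈-allFin _) (∈-elements⁺ e∈)

    ∈-exponentList⁻ : ∀ {e} → e ∈ exponentList → exponents X e
    ∈-exponentList⁻ e∈ = ∈-elements⁻ (proj₂ (∈-filter⁻ _ {xs = allFin m} e∈))

    -- Each nonzero element of `X` has exactly one exponent, so 0 together with the listed powers is
    -- a second duplicate-free list of `X`; the `∸ 1` accounts for 0.
    length-exponentList : length exponentList ≡ 2 ^ k ∸ 1
    length-exponentList = begin
      length exponentList      ≡⟨ length-map power exponentList ⟨
      length nonzero           ≡⟨ cong (_∸ 1) (unique-length (0∉ ∷ nonzero-unique) elements-unique ⊆ˡ ⊆ʳ) ⟩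
      length elements ∸ 1      ≡⟨ cong (_∸ 1) (trans (length-map _ (bitVectors k)) (length-bitVectors k)) ⟩
      2 ^ k ∸ 1                ∎
      where
      open ≡-Reasoning
      power : ℤ₂ₙ₋₁ → Fin (2 ^ n)
      power e = E.from (α ^ᶠ toℕ e)
      nonzero : List (Fin (2 ^ n))
      nonzero = map power exponentList
      nonzero-unique : Unique nonzero
      nonzero-unique = Unique.map⁺ (α^-injective ∘ from-injective) exponentList-unique
      0∉ : All (E.from 0# ≢_) nonzero
      0∉ = All.tabulate λ y∈ eq → case (∈-map⁻ power y∈) of λ where
        (e , _ , eq′) → α^≉0 (toℕ e) (F.sym (from-injective (trans eq eq′)))
      ⊆ˡ : E.from 0# ∷ nonzero ⊆ elements
      ⊆ˡ (here refl) = ∈-elements⁺ 0-closed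
      ⊆ˡ (there y∈) with e , e∈ , refl ← ∈-map⁻ power y∈ = ∈-elements⁺ (∈-exponentList⁻ e∈)
      ⊆ʳ : elements ⊆ E.from 0# ∷ nonzero
      ⊆ʳ {y} y∈ with y Fin.≟ E.from 0#
      ... | yes y≡0 = here y≡0
      ... | no y≢0 with e , eq ← ∃-log (λ y≈0 → y≢0 (trans (sym (E.strictlyInverseʳ y)) (E.from-cong y≈0)))
          = there (subst (_∈ nonzero) (trans (E.from-cong (F.sym eq)) (E.strictlyInverseʳ y))
              (∈-map⁺ power (∈-exponentList⁺ {e} (resp eq (∈-elements⁻ (subst (_∈ elements) (sym (E.strictlyInverseʳ y)) y∈))))))

    -- Pairs on the diagonal are sent to a disjoint copy, so that the whole of
    -- exponentList × exponentList covers a set of its own size.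
    cosetComplete⇒injective : CosetComplete k X → ∀ {x y x′ y′} →
      exponents X x → exponents X y → exponents X x′ → exponents X y′ → x ≢ y → x′ ≢ y′ →
      ρ (x -ₘ y) ≡ ρ (x′ -ₘ y′) → (x , y) ≡ (x′ , y′)
    cosetComplete⇒injective (ds , ds-unique , ds-spec , ds-length) {x} {y} {x′} {y′} x∈ y∈ x′∈ y′∈ x≢y x′≢y′ eq =
      covering⇒injective (≡-dec Fin._≟_ Fin._≟_) f ys-unique (ℕ.≤-reflexive lengths) covered
        (∈-pairs x∈ y∈) (∈-pairs x′∈ y′∈)
        (trans (f-off x≢y) (trans (cong inj₂ eq) (sym (f-off x′≢y′))))
      where
      f : ℤ₂ₙ₋₁ × ℤ₂ₙ₋₁ → ℤ₂ₙ₋₁ ⊎ ℤ₂ₙ₋₁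
      f (u , v) = if does (u Fin.≟ v) then inj₁ u else inj₂ (ρ (u -ₘ v))

      f-diag : ∀ u → f (u , u) ≡ inj₁ u
      f-diag u rewrite dec-true (u Fin.≟ u) refl = refl

      f-off : ∀ {u v} → u ≢ v → f (u , v) ≡ inj₂ (ρ (u -ₘ v))
      f-off {u} {v} u≢v rewrite dec-false (u Fin.≟ v) u≢v = refl

      pairs : List (ℤ₂ₙ₋₁ × ℤ₂ₙ₋₁)
      pairs = cartesianProduct exponentList exponentList

      ∈-pairs : ∀ {u v} → exponents X u → exponents X v → (u , v) ∈ pairs
      ∈-pairs u∈ v∈ = ∈-cartesianProduct⁺ (∈-exponentList⁺ u∈) (∈-exponentList⁺ v∈)

      ys : List (ℤ₂ₙ₋₁ ⊎ ℤ₂ₙ₋₁)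
      ys = map inj₁ exponentList ++ map inj₂ ds

      ys-unique : Unique ys
      ys-unique = Unique.++⁺ (Unique.map⁺ inj₁-injective exponentList-unique)
        (Unique.map⁺ inj₂-injective ds-unique) disjoint
        where
        disjoint : ∀ {z} → ¬ (z ∈ map inj₁ exponentList × z ∈ map inj₂ ds)
        disjoint (z∈₁ , z∈₂) with _ , _ , refl ← ∈-map⁻ inj₁ z∈₁ with _ , _ , () ← ∈-map⁻ inj₂ z∈₂

      covered : ys ⊆ map f pairs
      covered z∈ with ∈-++⁻ (map inj₁ exponentList) z∈
      ... | inj₁ z∈₁ with u , u∈ , refl ← ∈-map⁻ inj₁ z∈₁ =
        subst (_∈ map f pairs) (f-diag u) (∈-map⁺ f (∈-cartesianProduct⁺ u∈ u∈))
      ... | inj₂ z∈₂ with t , t∈ , refl ← ∈-map⁻ inj₂ z∈₂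
        with u , v , u∈ , v∈ , u≢v , refl ← Equivalence.to (ds-spec t) t∈ =
        subst (_∈ map f pairs) (f-off u≢v) (∈-map⁺ f (∈-pairs u∈ v∈))

      w = 2 ^ k ∸ 1

      -- Diagonal pairs plus off-diagonal pairs; the truncation of `u ∸ 1` at u = 0 is absorbed by
      -- the factor u.
      square : ∀ u → u * u ≡ u + u * (u ∸ 1)
      square zero    = refl
      square (suc u) = ℕ.*-suc (suc u) u

      lengths : length pairs ≡ length ys
      lengths = begin
        length pairs                          ≡⟨ length-cartesianProductWith _,_ exponentList exponentList ⟩
        length exponentList * length exponentList  ≡⟨ cong₂ _*_ length-exponentList length-exponentList ⟩
        w * w                                 ≡⟨ square w ⟩
        w + w * (w ∸ 1)                       ≡⟨ cong (λ z → w + w * z) (ℕ.∸-+-assoc (2 ^ k) 1 1) ⟩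
        w + w * (2 ^ k ∸ 2)                   ≡⟨ cong₂ _+_ (trans (length-map inj₁ exponentList) length-exponentList)
                                                    (trans (length-map inj₂ ds) ds-length) ⟨
        length (map inj₁ exponentList) + length (map inj₂ ds) ≡⟨ length-++ (map inj₁ exponentList) ⟨
        length ys                             ∎
        where open ≡-Reasoning

  -- Translates αʲ X^(2ˡ) in terms of exponents.

  -- Logarithms turn y = αʲ x^(2ˡ) into log y = j + 2ˡ log x. The preimage x has a logarithm because
  -- x = 0 would make a power of α vanish.
  translate-log : ∀ {X : Pred Carrier (c ⊔ ℓ)} → (∀ {x y} → x ≈ y → X x → X y) →
    ∀ (j : ℤ₂ₙ₋₁) l i → translate (toℕ j) l X (α ^ᶠ i) →
    ∃[ x ] (exponents X x × i mod (2 ^ n ∸ 1) ≡ j +ₘ dilate l x)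
  translate-log resp j l i (x , x∈ , eq) = e , resp x≈αᵉ x∈ , (begin
    i mod m                              ≡⟨ α^-≈⇒mod≡ power ⟩
    (toℕ j + toℕ e * 2 ^ l) mod m        ≡⟨ mod-+ (toℕ j) (toℕ e * 2 ^ l) ⟩
    toℕ j mod m +ₘ dilate l e            ≡⟨ cong (_+ₘ dilate l e) (mod-toℕ j) ⟩
    j +ₘ dilate l e                      ∎)
    where
    open ≡-Reasoning
    0^2^l≈0 : 0# ^ᶠ (2 ^ l) ≈ 0#
    -- Positivity of the exponent 2ˡ is essential, as 0⁰ = 1.
    0^2^l≈0 with 2 ^ l | ℕ.m^n>0 2 l
    ... | suc r | _ = F.zeroˡ (0# ^ᶠ r)
    x≉0 : ¬ x ≈ 0#
    x≉0 x≈0 = α^≉0 i (F.trans eq (F.trans (F.*-congˡ (F.trans (^-congˡ (2 ^ l) x≈0) 0^2^l≈0)) (F.zeroʳ _)))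
    e = proj₁ (∃-log x≉0)
    x≈αᵉ = proj₂ (∃-log x≉0)
    power : α ^ᶠ i ≈ α ^ᶠ (toℕ j + toℕ e * 2 ^ l)
    power = F.trans eq (F.trans (F.*-congˡ (F.trans (^-congˡ (2 ^ l) x≈αᵉ) (^-assocʳ α (toℕ e) (2 ^ l))))
      (F.sym (^-homo-* α (toℕ j) (toℕ e * 2 ^ l))))

  translate-contains⇒difference : ∀ {X : Pred Carrier (c ⊔ ℓ)} →
    (∀ {x y} → x ≈ y → X x → X y) → ∀ (j d : ℤ₂ₙ₋₁) l →
    translate (toℕ j) l X 1# → translate (toℕ j) l X (α ^ᶠ toℕ d) →
    ∃[ x ] ∃[ y ] (exponents X x × exponents X y × dilate l x -ₘ dilate l y ≡ d)
  translate-contains⇒difference resp j d l 1∈ αᵈ∈ =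
    -- `1#` is `α ^ᶠ 0` by computation, hence the exponent 0.
    let y , y∈ , eqy = translate-log resp j l 0 1∈
        x , x∈ , eqx = translate-log resp j l (toℕ d) αᵈ∈
    in x , y , x∈ , y∈ , sym (x≈z//y _ _ _ (begin
      d +ₘ dilate l y                        ≡⟨ cong (_+ₘ dilate l y) (trans (sym (mod-toℕ d)) eqx) ⟩
      (j +ₘ dilate l x) +ₘ dilate l y        ≡⟨ cong (_+ₘ dilate l y) (+ₘ-comm j (dilate l x)) ⟩
      (dilate l x +ₘ j) +ₘ dilate l y        ≡⟨ +ₘ-assoc (dilate l x) j (dilate l y) ⟩
      dilate l x +ₘ (j +ₘ dilate l y)        ≡⟨ cong (dilate l x +ₘ_) eqy ⟨
      dilate l x +ₘ 0ₘ                       ≡⟨ trans (+ₘ-comm (dilate l x) 0ₘ) (+ₘ-identityˡ _) ⟩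
      dilate l x                             ∎))
    where open ≡-Reasoning

-- The blocks and their differences.

module DifferenceFamily {c ℓ} (n : ℕ) (n-prime : Prime n) .{{_ : NonZero n}}
  (F : FiniteField c ℓ (2 ^ n)) (α : FiniteField.Carrier F)
  (α-primitive : FiniteField.IsPrimitive F α) where

  open Cyclotomic n
  open Subspaces F α
  open Dilation n
  open Logarithm n F α α-primitive
  open FiniteField F using (Carrier; _≈_; _^ᶠ_; 0#; 1#; 1≉0)

  module _ {k N : ℕ} (2≤k : 2 ≤ k) (X : Fin N → Pred Carrier (c ⊔ ℓ))
    (dim : ∀ i → IsSubspaceOfDim (vectorSpace n F) k (X i))
    (complete : ∀ i → CosetComplete k (X i))
    (disjoint : ∀ i j → i ≢ j → Disjoint (X i) (X j))
    (steiner : IsSteinerStructure (vectorSpace n F) k n (orbits X)) where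

    open IsSteinerStructure steiner using (covers)

    exps : Fin N → List ℤ₂ₙ₋₁
    exps i = exponentList (dim i)

    points : Fin N × Fin n → List ℤ₂ₙ₋₁
    points (i , l) = map (dilate (toℕ l)) (exps i)

    points-unique : ∀ q → Unique (points q)
    points-unique (i , l) = Unique.map⁺ (dilate-injective (toℕ l)) (exponentList-unique (dim i))

    block : Fin N × Fin n → Subset (2 ^ n ∸ 1)
    block q = fromList (points q)

    ∣block∣ : ∀ q → ∣ block q ∣ ≡ 2 ^ k ∸ 1
    ∣block∣ q@(i , l) = trans (∣fromList∣ (points-unique q))
      (trans (length-map (dilate (toℕ l)) (exps i)) (length-exponentList (dim i)))

    -- The order of the three conclusions is forced: i must agree before the completeness of a
    -- single subspace applies, and the pair must agree before both dilations act on the same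
    -- nonzero element, which is what determines l.
    exponent-differences-distinct : ∀ {i i′} (l l′ : Fin n) {x y x′ y′} →
      exponents (X i) x → exponents (X i) y → exponents (X i′) x′ → exponents (X i′) y′ → x ≢ y → x′ ≢ y′ →
      dilate (toℕ l) (x -ₘ y) ≡ dilate (toℕ l′) (x′ -ₘ y′) →
      (i , l) ≡ (i′ , l′) × (x , y) ≡ (x′ , y′)
    exponent-differences-distinct {i} {i′} l l′ {x} {y} {x′} {y′} x∈ y∈ x′∈ y′∈ x≢y x′≢y′ eq =
      same-subspace same-index x′∈ y′∈
      where
      ρ-eq : ρ (x -ₘ y) ≡ ρ (x′ -ₘ y′)
      ρ-eq = dilate≡⇒ρ≡ (toℕ l) (toℕ l′) eq

      same-index : i ≡ i′
      same-index = decidable-stable (i Fin.≟ i′) λ i≢i′ → disjoint i i′ i≢i′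
        ((x , y , x∈ , y∈ , x≢y , refl) , (x′ , y′ , x′∈ , y′∈ , x′≢y′ , ρ-eq))

      same-subspace : ∀ {i′} → i ≡ i′ → exponents (X i′) x′ → exponents (X i′) y′ →
        (i , l) ≡ (i′ , l′) × (x , y) ≡ (x′ , y′)
      same-subspace refl x′∈ y′∈ = cong (i ,_) (Fin.toℕ-injective
          (dilate-exponent-injective n-prime (x≢y ∘ x∙y⁻¹≈ε⇒x≈y x y) (Fin.toℕ<n l) (Fin.toℕ<n l′)
            (trans eq (cong (λ r → dilate (toℕ l′) (proj₁ r -ₘ proj₂ r)) (sym same-pair)))))
        , same-pair
        where
        same-pair : (x , y) ≡ (x′ , y′)
        same-pair = cosetComplete⇒injective (dim i) (complete i) x∈ y∈ x′∈ y′∈ x≢y x′≢y′ ρ-eq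

    -- Dilation commutes with subtraction, so a difference inside a block is a dilated difference of
    -- exponents of one subspace.
    block-differences-distinct : ∀ q q′ {x y x′ y′} →
      x ∈ points q → y ∈ points q → x′ ∈ points q′ → y′ ∈ points q′ → x ≢ y → x′ ≢ y′ →
      x -ₘ y ≡ x′ -ₘ y′ → q ≡ q′ × (x , y) ≡ (x′ , y′)
    block-differences-distinct q@(i , l) q′@(i′ , l′) x∈ y∈ x′∈ y′∈ =
      descend (∈-map⁻ (dilate (toℕ l)) x∈) (∈-map⁻ (dilate (toℕ l)) y∈)
        (∈-map⁻ (dilate (toℕ l′)) x′∈) (∈-map⁻ (dilate (toℕ l′)) y′∈)
      where
      descend : ∀ {x y x′ y′} →
        ∃[ u ] (u ∈ exps i × x ≡ dilate (toℕ l) u) → ∃[ v ] (v ∈ exps i × y ≡ dilate (toℕ l) v) →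
        ∃[ u ] (u ∈ exps i′ × x′ ≡ dilate (toℕ l′) u) → ∃[ v ] (v ∈ exps i′ × y′ ≡ dilate (toℕ l′) v) →
        x ≢ y → x′ ≢ y′ → x -ₘ y ≡ x′ -ₘ y′ → q ≡ q′ × (x , y) ≡ (x′ , y′)
      descend (u , u∈ , refl) (v , v∈ , refl) (u′ , u′∈ , refl) (v′ , v′∈ , refl) x≢y x′≢y′ eq =
        proj₁ same , cong₂ (λ r t → dilate (toℕ (proj₂ r)) (proj₁ t) , dilate (toℕ (proj₂ r)) (proj₂ t))
                       (proj₁ same) (proj₂ same)
        where
        same : q ≡ q′ × (u , v) ≡ (u′ , v′)
        same = exponent-differences-distinct l l′
          (∈-exponentList⁻ (dim i) u∈) (∈-exponentList⁻ (dim i) v∈)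
          (∈-exponentList⁻ (dim i′) u′∈) (∈-exponentList⁻ (dim i′) v′∈)
          (x≢y ∘ cong (dilate (toℕ l))) (x′≢y′ ∘ cong (dilate (toℕ l′)))
          (trans (dilate-- (toℕ l) u v) (trans eq (sym (dilate-- (toℕ l′) u′ v′))))

    -- Here k ≥ 2 enters: a block has at least 3 points, hence a nonzero difference from which its
    -- index can be recovered.
    two-points : ∀ q → ∃[ x ] ∃[ y ] (x ∈ points q × y ∈ points q × x ≢ y)
    two-points q = first-two (points q) (points-unique q) 2≤
      where
      open ℕ.≤-Reasoning
      2≤ : 2 ≤ length (points q)
      2≤ = begin
        2                  ≤⟨ ℕ.n≤1+n 2 ⟩
        2 ^ 2 ∸ 1          ≤⟨ ℕ.∸-monoˡ-≤ 1 (ℕ.^-monoʳ-≤ 2 2≤k) ⟩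
        2 ^ k ∸ 1          ≡⟨ ∣block∣ q ⟨
        ∣ block q ∣        ≡⟨ ∣fromList∣ (points-unique q) ⟩
        length (points q)  ∎
      first-two : ∀ xs → Unique xs → 2 ≤ length xs → ∃[ x ] ∃[ y ] (x ∈ xs × y ∈ xs × x ≢ y)
      first-two (x ∷ [])     _                 (s≤s ())
      first-two (x ∷ y ∷ xs) ((x≢y ∷ _) ∷ _) _ = x , y , here refl , there (here refl) , x≢y

    -- Equal blocks share the nonzero difference supplied by `two-points`, and that difference
    -- determines the index. This keeps the family free of repetitions.
    block-injective : ∀ {q q′} → block q ≡ block q′ → q ≡ q′
    block-injective {q} {q′} eq =
      let x , y , x∈ , y∈ , x≢y = two-points q in
      proj₁ (block-differences-distinct q q′ x∈ y∈ (move x∈) (move y∈) x≢y x≢y refl)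
      where
      move : ∀ {z} → z ∈ points q → z ∈ points q′
      move z∈ = ∈-fromList⁻ (subst (_ Subset.∈_) eq (∈-fromList⁺ z∈))

    ∃-difference : ∀ d → d ≢ 0ₘ → ∃[ q ] ∃[ x ] ∃[ y ] (x ∈ points q × y ∈ points q × x -ₘ y ≡ d)
    ∃-difference d d≢0 =
      let B , (i , l , j , B⊆ , _) , T⊆B , _ = covers (plane 1# (α ^ᶠ toℕ d))
            (plane-isSubspaceOfDim 1# (α ^ᶠ toℕ d) 1≉0 (α^≉0 (toℕ d))
              (d≢0 ∘ 1≈α^⇒≡0))
          x , y , x∈ , y∈ , eq = translate-contains⇒difference
            (IsSubspace.resp (IsSubspaceOfDim.isSubspace (dim i))) j d (toℕ l)
            (B⊆ (T⊆B (x∈plane 1# (α ^ᶠ toℕ d)))) (B⊆ (T⊆B (y∈plane 1# (α ^ᶠ toℕ d))))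
      in (i , l) , dilate (toℕ l) x , dilate (toℕ l) y
       , ∈-map⁺ (dilate (toℕ l)) (∈-exponentList⁺ (dim i) {x} x∈)
       , ∈-map⁺ (dilate (toℕ l)) (∈-exponentList⁺ (dim i) {y} y∈) , eq

    indices : List (Fin N × Fin n)
    indices = cartesianProduct (allFin N) (allFin n)

    family : List (Subset (2 ^ n ∸ 1))
    family = map block indices

    IsFamilyTriple : ℤ₂ₙ₋₁ → Pred (Subset (2 ^ n ∸ 1) × ℤ₂ₙ₋₁ × ℤ₂ₙ₋₁) _
    IsFamilyTriple = IsDifferenceTriple {_+ᴳ_ = _+ₘ_} {0ₘ} {neg} family

    family-differences : ∀ d → d ≢ 0ₘ → HasSize (IsFamilyTriple d) 1
    family-differences d d≢0 =
      let q , x , y , x∈ , y∈ , x-y≡d = ∃-difference d d≢0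
          x≢y = λ x≡y → d≢0 (trans (sym x-y≡d) (trans (cong (_-ₘ y) x≡y) (inverseʳ y)))
      in (block q , x , y) ∷ [] , [] ∷ []
       , (λ t → mk⇔ (sound q x∈ y∈ x≢y x-y≡d) (only q x∈ y∈ x≢y x-y≡d)) , refl
      where
      open IsGroup ℤ₂ₙ₋₁-isGroup using (inverseʳ)
      sound : ∀ q {x y} → x ∈ points q → y ∈ points q → x ≢ y → x -ₘ y ≡ d →
        ∀ {t} → t ∈ (block q , x , y) ∷ [] → IsFamilyTriple d t
      sound (i , l) x∈ y∈ x≢y x-y≡d (here refl) =
        ∈-map⁺ block (∈-cartesianProduct⁺ (∈-allFin i) (∈-allFin l))
        , ∈-fromList⁺ x∈ , ∈-fromList⁺ y∈ , x≢y , x-y≡d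

      only : ∀ q {x y} → x ∈ points q → y ∈ points q → x ≢ y → x -ₘ y ≡ d →
        ∀ {t} → IsFamilyTriple d t → t ∈ (block q , x , y) ∷ []
      only q {x} {y} x∈ y∈ x≢y x-y≡d {B , x′ , y′} (B∈ , x′∈ , y′∈ , x′≢y′ , x′-y′≡d) =
        here (cong₂ _,_ (trans B≡ (cong block (proj₁ same))) (proj₂ same))
        where
        q′ = proj₁ (∈-map⁻ block B∈)
        B≡ : B ≡ block q′
        B≡ = proj₂ (proj₂ (∈-map⁻ block B∈))
        same : q′ ≡ q × (x′ , y′) ≡ (x , y)
        same = block-differences-distinct q′ q
          (∈-fromList⁻ (subst (x′ Subset.∈_) B≡ x′∈)) (∈-fromList⁻ (subst (y′ Subset.∈_) B≡ y′∈))
          x∈ y∈ x′≢y′ x≢y (trans x′-y′≡d (sym x-y≡d))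

    family-isDifferenceFamily : IsDifferenceFamily ℤ₂ₙ₋₁-isGroup (2 ^ k ∸ 1) 1 family
    family-isDifferenceFamily = record
      { unique      = Unique.map⁺ block-injective (Unique.cartesianProduct⁺ (Unique.allFin⁺ N) (Unique.allFin⁺ n))
      ; block-size  = λ B B∈ → case (∈-map⁻ block B∈) of λ { (q , _ , refl) → ∣block∣ q }
      ; differences = family-differences
      }

theorem4 : ∀ {c ℓ : Level} (n : ℕ) (n-prime : Prime n) →
    let open Cyclotomic n {{prime⇒nonZero n-prime}} in
    (F : FiniteField c ℓ (2 ^ n)) (α : FiniteField.Carrier F) →
    let open Subspaces F α in
    FiniteField.IsPrimitive F α →
    (k : ℕ) → 2 ≤ k →
    (N : ℕ) → N * ((2 ^ k ∸ 1) * (2 ^ k ∸ 2) * n) ≡ 2 ^ n ∸ 2 →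
    (X : Fin N → Pred (FiniteField.Carrier F) (c ⊔ ℓ)) →
    (∀ i → IsSubspaceOfDim (vectorSpace n F) k (X i)) →
    (∀ i → CosetComplete k (X i)) →
    (∀ i j → i ≢ j → Disjoint (X i) (X j)) →
    IsSteinerStructure (vectorSpace n F) k n (orbits X) →
    ∃[ 𝓑 ] IsDifferenceFamily ℤ₂ₙ₋₁-isGroup (2 ^ k ∸ 1) 1 𝓑
theorem4 n n-prime F α α-primitive k 2≤k N _ X dim complete disjoint steiner =
  family 2≤k X dim complete disjoint steiner , family-isDifferenceFamily 2≤k X dim complete disjoint steiner
  where open DifferenceFamily n n-prime {{prime⇒nonZero n-prime}} F α α-primitive
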